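{- Let $(\Sigma,A)$ be a finitary algebra whose underlying set $A$ is finite. Then the finitary double centralizer $(\Sigma^A)^{\perp\perp(\aleph_0)}$ is the set of all finitary operations $f:A^n \rightarrow A$ such that $h(f) = f\bigl((h(\pi_i))_{i \in n}\bigr)$ for every $\Sigma$-homomorphism $h:A^{(A^n)} \rightarrow A$, where $\pi_i:A^n\to A$ $(i\in n)$ denote the projections.
   Context: A finitary operation on a set $A$ is a map $A^n\to A$ with $n$ a finite cardinal ($n=\{0,\dots,n-1\}$; $n=0$ is allowed). A finitary signature is a set $\Sigma$ with an assignment of a finite cardinal, its arity, to each $\sigma\in\Sigma$. A $\Sigma$-algebra is a set $A$ equipped with an operation $\sigma^A:A^n\to A$ for each $\sigma\in\Sigma$, where $n$ is the arity of $\sigma$; a $\Sigma$-homomorphism is a map preserving these basic operations. A finitary algebra is a pair $(\Sigma,A)$ of a finitary signature $\Sigma$ and a $\Sigma$-algebra $A$; write $\Sigma^A=\{\sigma^A\mid\sigma\in\Sigma\}$. Each power $A^Y$ is a $\Sigma$-algebra under the pointwise operations; in particular $A^{(A^n)}$ is a $\Sigma$-algebra. Operations $f:A^n\to A$ and $g:A^m\to A$ commute, written $f\perp g$, if for every matrix $a=(a_{ij})\in A^{n\times m}$ one has $g\bigl((f((a_{ij})_{i\in n}))_{j\in m}\bigr)=f\bigl((g((a_{ij})_{j\in m}))_{i\in n}\bigr)$. For a set $G$ of finitary operations on $A$, $G^{\perp(\aleph_0)}$ is the set of all finitary operations $f$ on $A$ with $f\perp g$ for all $g\in G$, and $G^{\perp\perp(\aleph_0)}$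 is the result of applying $(-)^{\perp(\aleph_0)}$ twice to $G$. In $h(f)$, the map $f:A^n\to A$ is regarded as an element of $A^{(A^n)}$. -}

-- Sets are rendered as setoids: a map between sets is a congruent function
-- (Func), and two maps are equal when they are pointwise equal.  This makes
-- A^Y, and in particular A^(A^n), behave extensionally without postulating
-- function extensionality.  A set in the naive sense is the special case
-- where the setoid equality is propositional equality.

module Defs where

open import Level using (Level; _⊔_; suc)
open import Data.Nat.Base using (ℕ)
open import Data.Fin.Base using (Fin)
open import Data.Product.Base using (Σ; ∃; _,_; proj₂)
open import Data.Vec.Functional using (Vector)
open import Data.Vec.Functional.Relation.Binary.Equality.Setoid using (≋-setoid)
open import Function.Base using (_∘_)
open import Function.Bundles using (Func; Inverse; _⟨$⟩_)
open import Function.Relation.Binary.Setoid.Equality using (_⇨_)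
open import Relation.Binary.Bundles using (Setoid)
open import Relation.Binary.PropositionalEquality.Properties as ≡ using ()
open import Relation.Unary using (Pred)

Finite : ∀ {a ℓ} → Setoid a ℓ → Set (a ⊔ ℓ)
Finite A = ∃ λ k → Inverse (≡.setoid (Fin k)) A

infix 8 _^_
_^_ : ∀ {a ℓ} → Setoid a ℓ → ℕ → Setoid a ℓ
A ^ n = ≋-setoid A n

Operation : ∀ {a ℓ} → Setoid a ℓ → ℕ → Set (a ⊔ ℓ)
Operation A n = Func (A ^ n) A

FinitaryOperation : ∀ {a ℓ} → Setoid a ℓ → Set (a ⊔ ℓ)
FinitaryOperation A = Σ ℕ (Operation A)

module _ {a ℓ} (A : Setoid a ℓ) where
  open Setoid A

  π : ∀ {n} → Fin n → Operation A n
  π i = record { to = λ x → x i ; cong = λ x≋y → x≋y i }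

  Commute : ∀ {n m} → Operation A n → Operation A m → Set (a ⊔ ℓ)
  Commute {n} {m} f g = (x : Fin n → Fin m → Carrier) →
    g ⟨$⟩ (λ j → f ⟨$⟩ (λ i → x i j)) ≈ f ⟨$⟩ (λ i → g ⟨$⟩ (λ j → x i j))

module _ {a ℓ} {A : Setoid a ℓ} where

  infix 9 _⊥ _⊥⊥

  _⊥ : ∀ {p} → Pred (FinitaryOperation A) p → Pred (FinitaryOperation A) (a ⊔ ℓ ⊔ p)
  (G ⊥) f = ∀ g → G g → Commute A (proj₂ f) (proj₂ g)

  _⊥⊥ : ∀ {p} → Pred (FinitaryOperation A) p → Pred (FinitaryOperation A) (a ⊔ ℓ ⊔ p)
  G ⊥⊥ = (G ⊥) ⊥

record Signature s : Set (suc s) where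
  field
    Symbol : Set s
    arity  : Symbol → ℕ

open Signature public

record Algebra {s} (S : Signature s) a ℓ : Set (s ⊔ suc (a ⊔ ℓ)) where
  field
    setoid : Setoid a ℓ
    op     : (σ : Symbol S) → Operation setoid (arity S σ)

  open Setoid setoid public using (Carrier; _≈_)

module _ {s} {S : Signature s} where

  open Algebra

  -- Σ^A as a subset of the finitary operations, closed under equality of
  -- operations.
  data BasicOperation {a ℓ} (A : Algebra S a ℓ) :
                      Pred (FinitaryOperation (setoid A)) (s ⊔ a ⊔ ℓ) where
    basic : ∀ σ {f : Operation (setoid A) (arity S σ)} →
            (∀ x → _≈_ A (f ⟨$⟩ x) (op A σ ⟨$⟩ x)) →
            BasicOperation A (arity S σ , f)

  record Hom {a₁ ℓ₁ a₂ ℓ₂} (A : Algebra S a₁ ℓ₁) (B : Algebra S a₂ ℓ₂) :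
             Set (s ⊔ a₁ ⊔ ℓ₁ ⊔ a₂ ⊔ ℓ₂) where
    field
      map       : Func (setoid A) (setoid B)
      preserves : ∀ σ (x : Vector (Carrier A) (arity S σ)) →
                  _≈_ B (map ⟨$⟩ (op A σ ⟨$⟩ x))
                        (op B σ ⟨$⟩ ((map ⟨$⟩_) ∘ x))

    open Func map public using (to)

  Power : ∀ {a ℓ y ℓ′} → Algebra S a ℓ → Setoid y ℓ′ →
          Algebra S (a ⊔ ℓ ⊔ y ⊔ ℓ′) (ℓ ⊔ y)
  Power A Y = record
    { setoid = Y ⇨ setoid A
    ; op     = λ σ → record
      { to   = λ φ → record
        { to   = λ y → op A σ ⟨$⟩ (λ i → φ i ⟨$⟩ y)
        ; cong = λ y≈y′ → Func.cong (op A σ) (λ i → Func.cong (φ i) y≈y′)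
        }
      ; cong = λ φ≋ψ y → Func.cong (op A σ) (λ i → φ≋ψ i y)
      }
    }

{-# OPTIONS --safe #-}
-- A homomorphism h : A^(A^n) → A is an operation in (Σ^A)^⊥ of arity |A^n|,
-- finite because A is; that f commutes with it at the matrix whose columns are all
-- the elements of A^n says h(f) = f(h(π_i)).  Conversely, an operation g in (Σ^A)^⊥
-- and a matrix x with n rows and m columns x_j give the homomorphism
-- φ ↦ g(φ(x_0), …, φ(x_{m-1})), for which the condition on f is the commutation of f and g at x.
module Submission where

open import Defs
open import Data.Fin.Base using (Fin; combine; finToFun; funToFin; zero; suc)
open import Data.Fin.Properties using (finToFun-funToFin)
open import Data.Nat.Base as ℕ using (ℕ)
open import Data.Product.Base using (_,_)
open import Function.Base using (_∘_)
open import Function.Bundles using (Func; Inverse; _⟨$⟩_)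
open import Relation.Binary.Bundles using (Setoid)
open import Relation.Binary.PropositionalEquality as ≡ using (_≡_; _≗_)
import Relation.Binary.Reasoning.Setoid as SetoidReasoning
open import Relation.Unary using (_≐_)

funToFin-cong : ∀ {m n} {f g : Fin m → Fin n} → f ≗ g → funToFin f ≡ funToFin g
funToFin-cong {ℕ.zero}  f≗g = ≡.refl
funToFin-cong {ℕ.suc m} f≗g = ≡.cong₂ combine (f≗g zero) (funToFin-cong (f≗g ∘ suc))

module _ {a ℓ} {A : Setoid a ℓ} {k : ℕ} (enum : Inverse (≡.setoid (Fin k)) A) (n : ℕ) where
  open Setoid A
  open Inverse enum using (to; from; from-cong; strictlyInverseˡ)

  tuple : Fin (k ℕ.^ n) → Fin n → Carrier
  tuple j = to ∘ finToFun j

  index : (Fin n → Carrier) → Fin (k ℕ.^ n)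
  index y = funToFin (from ∘ y)

  -- The conclusion is `≡`, not an equality in `A`, because `from` lands in `Fin k`; this is what
  -- makes `x ∘ index` a congruent map for arbitrary `x`.
  index-cong : ∀ {y z} → (∀ i → y i ≈ z i) → index y ≡ index z
  index-cong y≋z = funToFin-cong (from-cong ∘ y≋z)

  tuple-index : ∀ y i → tuple (index y) i ≈ y i
  tuple-index y i = trans
    (reflexive (≡.cong to (finToFun-funToFin (from ∘ y) i)))
    (strictlyInverseˡ (y i))

module _ {s a ℓ} {S : Signature s} (A : Algebra S a ℓ) where
  open Algebra A
  open Setoid setoid using (refl; sym; trans; reflexive)

  module _ {k n : ℕ} (enum : Inverse (≡.setoid (Fin k)) setoid)
           (h : Hom (Power A (setoid ^ n)) A) where

    onIndices : (Fin (k ℕ.^ n) → Carrier) → Func (setoid ^ n) setoid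
    onIndices x = record
      { to   = x ∘ index enum n
      ; cong = λ y≋z → reflexive (≡.cong x (index-cong enum n y≋z))
      }

    homOperation : Operation setoid (k ℕ.^ n)
    homOperation = record
      { to   = Hom.to h ∘ onIndices
      ; cong = λ x≋y → Func.cong (Hom.map h) (x≋y ∘ index enum n)
      }

    -- Precomposition with `index` respects the pointwise operations, so commuting with `σ` is
    -- preservation of `σ` by `h`; `f≈σ` is used on both sides since `f` only agrees with `op A σ`
    -- pointwise.
    homOperation∈⊥ : (BasicOperation A ⊥) (k ℕ.^ n , homOperation)
    homOperation∈⊥ _ (basic σ f≈σ) x = trans (f≈σ _) (trans
      (sym (Hom.preserves h σ (λ j → onIndices (λ i → x i j))))
      (Func.cong (Hom.map h) (λ y → sym (f≈σ _))))

    -- Reading the table of values of `φ` back through `index` recovers `φ`, as `tuple` undoes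
    -- `index` up to `≈`.
    homOperation-tuple : (φ : Operation setoid n) →
      homOperation ⟨$⟩ (λ j → φ ⟨$⟩ tuple enum n j) ≈ Hom.to h φ
    homOperation-tuple φ =
      Func.cong (Hom.map h) (λ y → Func.cong φ (tuple-index enum n y))

  module _ {n m : ℕ} (g : Operation setoid m) (g∈⊥ : (BasicOperation A ⊥) (m , g))
           (x : Fin n → Fin m → Carrier) where

    evalHom : Hom (Power A (setoid ^ n)) A
    evalHom = record
      { map       = record
        { to   = λ φ → g ⟨$⟩ (λ j → φ ⟨$⟩ (λ i → x i j))
        ; cong = λ φ≋ψ → Func.cong g (λ j → φ≋ψ (λ i → x i j))
        }
      -- The matrix has entry `φ l` at the column `x_j` in place `(j , l)`.
      ; preserves = λ σ φ → sym
          (g∈⊥ (_ , op σ) (basic σ (λ _ → refl)) (λ j l → φ l ⟨$⟩ (λ i → x i j)))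
      }

corollary6p4 : ∀ {s a ℓ} (S : Signature s) (A : Algebra S a ℓ) → (let open Algebra A) →
    Finite setoid →
    BasicOperation A ⊥⊥ ≐
    (λ (n , f) → (h : Hom (Power A (setoid ^ n)) A) →
    Hom.to h f ≈ f ⟨$⟩ (λ i → Hom.to h (π setoid i)))
corollary6p4 S A (_ , enum) =
  (λ { {n , f} f∈⊥⊥ h → begin
    Hom.to h f
      ≈⟨ homOperation-tuple A enum h f ⟨
    homOperation A enum h ⟨$⟩ (λ j → f ⟨$⟩ tuple enum n j)
      -- Row `i` of this matrix is the table of values of `π setoid i`.
      ≈⟨ f∈⊥⊥ (_ , homOperation A enum h) (homOperation∈⊥ A enum h) (λ i j → tuple enum n j i) ⟩
    f ⟨$⟩ (λ i → homOperation A enum h ⟨$⟩ (λ j → tuple enum n j i))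
      ≈⟨ Func.cong f (λ i → homOperation-tuple A enum h (π setoid i)) ⟩
    f ⟨$⟩ (λ i → Hom.to h (π setoid i)) ∎ }) ,
  -- At `π setoid i` the homomorphism returns `g` of row `i` of `x`, so both sides unfold to those
  -- of `Commute`.
  (λ { f-hom (_ , g) g∈⊥ x → f-hom (evalHom A g g∈⊥ x) })
  where
  open Algebra A
  open SetoidReasoning setoid
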